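{- For every integer $t \geq 3$, $$43 \cdot 3^{t-3} +1 \leq R_t(3).$$
   Context: A tournament of order $m$ is an orientation of the complete graph on $m$ vertices; it is transitive if its vertices can be listed $a_1,\dots,a_m$ with $a_i \to a_j$ for all $i<j$. The multicolor directed Ramsey number $R(n_1,n_2,\dots,n_t)$ is the smallest integer $m$ such that any tournament of order $m$ whose edges have been colored with $t$ colors contains, for some $1 \leq i \leq t$, a transitive subtournament of order $n_i$ all of whose edges have color $i$ (these numbers exist). $R_t(n)$ denotes $R(n,n,\dots,n)$ with $t$ arguments. -}

module Defs where

open import Level using (0ℓ)
open import Data.Empty using (⊥; ⊥-elim-irr)
open import Data.Fin.Base using (Fin; zero; suc)
open import Data.Fin.Properties using (_≟_; any?; all?)
open import Data.List.Base using (List; []; _∷_; length; filter; allFin)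
open import Data.List.Membership.Propositional using (_∈_)
open import Data.List.Membership.Propositional.Properties using (∈-filter⁻)
open import Data.List.Properties using (length-tabulate)
import Data.List.Relation.Unary.All as ListAll
import Data.List.Relation.Unary.AllPairs as ListAllPairs
open import Data.List.Relation.Unary.Any using (here; there)
open import Data.List.Relation.Unary.Unique.Propositional using (Unique)
import Data.List.Relation.Unary.Unique.Propositional.Properties as UniqueP
open import Data.Maybe.Base using (Maybe; just; nothing)
open import Data.Maybe using (Is-just)
open import Data.Maybe.Properties using (≡-dec; just-injective)
import Data.Maybe.Relation.Unary.Any as MaybeAny
open import Data.Nat.Base using (ℕ; zero; suc; pred; _+_; _≤_; _<_; z≤n; s≤s)
import Data.Nat.Properties as ℕ
open import Data.Product.Base using (Σ; ∃; _×_; _,_; proj₁; proj₂)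
open import Data.Unit.Base using (tt)
open import Data.Vec.Base using (Vec; []; _∷_; _∷ʳ_; lookup; sum; tabulate; replicate; updateAt)
open import Data.Vec.Properties
  using (lookup∘tabulate; lookup∘updateAt; lookup∘updateAt′)
open import Data.Vec.Relation.Unary.All as All using (All; []; _∷_)
open import Data.Vec.Relation.Unary.AllPairs as AllPairs using (AllPairs; []; _∷_)
open import Function.Base using (_∘_; id)
open import Relation.Binary.Core using (Rel)
open import Relation.Binary.Definitions using (Trichotomous; Tri; tri<; tri≈; tri>)
open import Relation.Binary.PropositionalEquality
  using (_≡_; _≢_; refl; sym; trans; cong; subst)
open import Relation.Nullary using (¬_; Dec; yes; no; contradiction; ¬?)
open import Relation.Nullary.Decidable using (map′; decidable-stable; _→-dec_)

-- For distinct u and v exactly one of u ⟶ v and v ⟶ u holds, and there are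
-- no loops.
record Tournament (m : ℕ) : Set₁ where
  field
    _⟶_     : Rel (Fin m) 0ℓ
    compare : Trichotomous _≡_ _⟶_

-- The arc proof is irrelevant so that a colour depends on the edge alone.
Colouring : ∀ {m} → Tournament m → ℕ → Set
Colouring T t = ∀ u v → .(u ⟶ v) → Fin t
  where open Tournament T

module _ {m t : ℕ} (T : Tournament m) (colour : Colouring T t) where
  open Tournament T

  ColouredArc : Fin t → Rel (Fin m) 0ℓ
  ColouredArc i u v = Σ (u ⟶ v) λ e → colour u v e ≡ i

  -- A listing a₁, …, aₙ with an arc of colour i from a_j to a_k whenever
  -- j < k. The vertices are distinct because there are no loops.
  MonochromaticTransitive : Fin t → ℕ → Set
  MonochromaticTransitive i n = Σ (Vec (Fin m) n) (AllPairs (ColouredArc i))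

Unavoidable : ∀ {t} → Vec ℕ t → ℕ → Set₁
Unavoidable {t} ns m =
  (T : Tournament m) (colour : Colouring T t) →
  ∃ λ i → MonochromaticTransitive T colour i (lookup ns i)

IsRamseyNumber : ∀ {t} → Vec ℕ t → ℕ → Set₁
IsRamseyNumber ns m = Unavoidable ns m × (∀ k → Unavoidable ns k → m ≤ k)

private
  sum-updateAt-pred : ∀ {k} (xs : Vec ℕ k) i → lookup xs i ≢ 0 →
                      suc (sum (updateAt xs i pred)) ≡ sum xs
  sum-updateAt-pred (zero  ∷ xs) zero    x≢0 = contradiction refl x≢0
  sum-updateAt-pred (suc x ∷ xs) zero    _   = refl
  sum-updateAt-pred (x     ∷ xs) (suc i) x≢0 =
    trans (sym (ℕ.+-suc x _)) (cong (x +_) (sum-updateAt-pred xs i x≢0))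

  suc-pred : ∀ {n} → n ≢ 0 → suc (pred n) ≡ n
  suc-pred {zero}  n≢0 = contradiction refl n≢0
  suc-pred {suc n} _   = refl

  class : ∀ {A : Set} {k} → (A → Fin k) → Fin k → List A → List A
  class f j = filter (λ x → f x ≟ j)

  class-unique : ∀ {A : Set} {k} (f : A → Fin k) j {xs} → Unique xs → Unique (class f j xs)
  class-unique f j = UniqueP.filter⁺ (λ x → f x ≟ j)

  pigeonhole : ∀ {A : Set} {k} (f : A → Fin k) (N : Vec ℕ k) (xs : List A) →
               sum N < length xs → ∃ λ j → lookup N j ≤ length (class f j xs)
  pigeonhole f N (x ∷ xs) (s≤s ΣN≤) with lookup N (f x) ℕ.≟ 0
  ... | yes N≡0 = f x , subst (_≤ _) (sym N≡0) z≤n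
  ... | no  N≢0
    with j , Nj≤ ← pigeonhole f (updateAt N (f x) pred) xs
                     (subst (_≤ length xs) (sym (sum-updateAt-pred N (f x) N≢0)) ΣN≤)
    with f x ≟ j in eq
  ... | yes refl = f x , subst (lookup N (f x) ≤_) (sym len)
                     (subst (_≤ suc (length (class f (f x) xs))) (suc-pred N≢0)
                       (s≤s (subst (_≤ _) (lookup∘updateAt (f x) N) Nj≤)))
    where
    len : length (class f (f x) (x ∷ xs)) ≡ suc (length (class f (f x) xs))
    len rewrite eq = refl
  ... | no fx≢j  = j , subst (lookup N j ≤_) (sym len)
                     (subst (_≤ _) (lookup∘updateAt′ j (f x) (fx≢j ∘ sym) N) Nj≤)
    where
    len : length (class f j (x ∷ xs)) ≡ length (class f j xs)
    len rewrite eq = refl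

  All-∷ʳ : ∀ {A : Set} {P : A → Set} {n} {xs : Vec A n} {x} →
           All P xs → P x → All P (xs ∷ʳ x)
  All-∷ʳ []         px = px ∷ []
  All-∷ʳ (py ∷ pys) px = py ∷ All-∷ʳ pys px

  AllPairs-∷ʳ : ∀ {A : Set} {R : Rel A 0ℓ} {n} {xs : Vec A n} {x} →
                AllPairs R xs → All (λ y → R y x) xs → AllPairs R (xs ∷ʳ x)
  AllPairs-∷ʳ []         []         = [] ∷ []
  AllPairs-∷ʳ (rs ∷ rss) (ry ∷ rys) = All-∷ʳ rs ry ∷ AllPairs-∷ʳ rss rys

  module _ {m t : ℕ} (T : Tournament m) (colour : Colouring T t) where
    open Tournament T

    MonochromaticWithin : List (Fin m) → Fin t → ℕ → Set
    MonochromaticWithin xs i n =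
      Σ (Vec (Fin m) n) λ as → All (_∈ xs) as × AllPairs (ColouredArc T colour i) as

    side : ∀ v u → Fin 2
    side v u with compare v u
    ... | tri< _ _ _ = zero
    ... | tri≈ _ _ _ = zero
    ... | tri> _ _ _ = suc zero

    edgeColour : Fin t → ∀ v u → Fin t
    edgeColour c v u with compare v u
    ... | tri< e _ _ = colour v u e
    ... | tri≈ _ _ _ = c
    ... | tri> _ _ e = colour u v e

    out-arc : ∀ {c i v u} → v ≢ u → side v u ≡ zero → edgeColour c v u ≡ i →
              ColouredArc T colour i v u
    out-arc {v = v} {u} v≢u s c with compare v u
    ... | tri< e _ _   = e , c
    ... | tri≈ _ v≡u _ = contradiction v≡u v≢u

    in-arc : ∀ {c i v u} → side v u ≡ suc zero → edgeColour c v u ≡ i →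
             ColouredArc T colour i u v
    in-arc {v = v} {u} s c with compare v u
    ... | tri> _ _ e = e , c

    some-colour : ∀ {v u} → v ≢ u → Fin t
    some-colour {v} {u} v≢u with compare v u
    ... | tri< e _ _   = colour v u e
    ... | tri≈ _ v≡u _ = contradiction v≡u v≢u
    ... | tri> _ _ e   = colour u v e

    module _ (c₀ : Fin t) (v : Fin m) (xs : List (Fin m)) (v≢ : ∀ {u} → u ∈ xs → v ≢ u)
             (d : Fin 2) (c : Fin t) where

      neighbours : List (Fin m)
      neighbours = class (edgeColour c₀ v) c (class (side v) d xs)

      neighbour : ∀ {u} → u ∈ neighbours →
                  u ∈ xs × side v u ≡ d × edgeColour c₀ v u ≡ c
      neighbour u∈
        with u∈ys , cu ← ∈-filter⁻ (λ x → edgeColour c₀ v x ≟ c) {xs = class (side v) d xs} u∈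
        with u∈xs , su ← ∈-filter⁻ (λ x → side v x ≟ d) {xs = xs} u∈ys
        = u∈xs , su , cu

      weaken : ∀ {n} {as : Vec (Fin m) n} → All (_∈ neighbours) as → All (_∈ (v ∷ xs)) as
      weaken = All.map (there ∘ proj₁ ∘ neighbour)

      attach : ∀ {n} → MonochromaticWithin neighbours c n →
               MonochromaticWithin (v ∷ xs) c (suc n)
      attach (as , as∈ , chain) = go d refl
        where
        go : ∀ d′ → d ≡ d′ → MonochromaticWithin (v ∷ xs) c (suc _)
        go zero d≡ = v ∷ as , here refl ∷ weaken as∈ , All.map arc as∈ ∷ chain
          where
          arc : ∀ {u} → u ∈ neighbours → ColouredArc T colour c v u
          arc u∈ with r , s , e ← neighbour u∈ = out-arc (v≢ r) (trans s d≡) e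
        go (suc zero) d≡ =
          as ∷ʳ v , All-∷ʳ (weaken as∈) (here refl) , AllPairs-∷ʳ chain (All.map arc as∈)
          where
          arc : ∀ {u} → u ∈ neighbours → ColouredArc T colour c u v
          arc u∈ with _ , s , e ← neighbour u∈ = in-arc (trans s d≡) e

  UnavoidableWithin : ∀ {t} → Vec ℕ t → ℕ → Set₁
  UnavoidableWithin ns N =
    ∀ {m} (T : Tournament m) colour (xs : List (Fin m)) → Unique xs → N ≤ length xs →
    ∃ λ i → MonochromaticWithin T colour xs i (lookup ns i)

  module _ {t} (ns : Vec ℕ t) (ns≢0 : ∀ i → lookup ns i ≢ 0) (M : Vec ℕ t)
           (ih : ∀ i → UnavoidableWithin (updateAt ns i pred) (lookup M i)) where

    halves : Vec ℕ 2
    halves = replicate 2 (suc (sum M))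

    extend : UnavoidableWithin ns (2 + sum halves)
    extend T colour (v ∷ xs@(w ∷ _))
           (v≢xs@(v≢w ListAll.∷ _) ListAllPairs.∷ uxs) (s≤s big) = conclude
      where
      c₀ = some-colour T colour v≢w
      dir = pigeonhole (side T colour v) halves xs big
      d = proj₁ dir

      half : ∀ (d : Fin 2) {l} → lookup halves d ≤ l → sum M < l
      half zero       p = p
      half (suc zero) p = p

      col = pigeonhole (edgeColour T colour c₀ v) M (class (side T colour v) d xs)
              (half d (proj₂ dir))
      c = proj₁ col

      zs = neighbours T colour c₀ v xs (ListAll.lookup v≢xs) d c

      conclude : ∃ λ i → MonochromaticWithin T colour (v ∷ xs) i (lookup ns i)
      conclude
        with i , found@(as , as∈ , chain) ← ih c T colour zs
               (class-unique (edgeColour T colour c₀ v) c (class-unique (side T colour v) d uxs)) (proj₂ col)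
        with i ≟ c
      ... | yes refl = i , subst (MonochromaticWithin T colour (v ∷ xs) i)
              (suc-pred (ns≢0 i))
              (attach T colour c₀ v xs (ListAll.lookup v≢xs) d c
                (subst (MonochromaticWithin T colour zs i) (lookup∘updateAt i ns) found))
      ... | no i≢c   = i , subst (MonochromaticWithin T colour (v ∷ xs) i)
              (lookup∘updateAt′ i c i≢c ns)
              (as , weaken T colour c₀ v xs (ListAll.lookup v≢xs) d c as∈ , chain)

  bound : ∀ {t} k (ns : Vec ℕ t) → sum ns ≤ k → ∃ (UnavoidableWithin ns)
  bound k ns Σ≤k with any? (λ i → lookup ns i ℕ.≟ 0)
  ... | yes (i , n≡0) = 0 , λ T colour xs _ _ →
          i , subst (MonochromaticWithin T colour xs i) (sym n≡0) ([] , [] , [])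
  bound {zero}  k       [] _ | no _ = _ , extend [] (λ ()) [] (λ ())
  bound {suc t} zero    ns Σ≤k | no ¬0 =
    contradiction (subst (_≤ 0) (sym (sum-updateAt-pred ns zero (λ e → ¬0 (zero , e)))) Σ≤k) λ ()
  bound {suc t} (suc k) ns Σ≤k | no ¬0 = _ , extend ns ns≢0 (tabulate (proj₁ ∘ rec))
      λ i → subst (UnavoidableWithin (updateAt ns i pred))
              (sym (lookup∘tabulate (proj₁ ∘ rec) i)) (proj₂ (rec i))
    where
    ns≢0 : ∀ i → lookup ns i ≢ 0
    ns≢0 i e = ¬0 (i , e)
    rec : ∀ i → ∃ (UnavoidableWithin (updateAt ns i pred))
    rec i = bound k (updateAt ns i pred)
      (ℕ.≤-pred (subst (_≤ suc k) (sym (sum-updateAt-pred ns i (ns≢0 i))) Σ≤k))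

  some-unavoidable : ∀ {t} (ns : Vec ℕ t) → ∃ (Unavoidable ns)
  some-unavoidable ns with N , within ← bound _ ns ℕ.≤-refl = N , λ T colour →
    let i , as , _ , chain = within T colour (allFin N) (UniqueP.allFin⁺ N)
                               (ℕ.≤-reflexive (sym (length-tabulate id)))
    in i , as , chain

private
  Searchable : Set → Set₁
  Searchable A = ∀ (P : A → Set) → (∀ a → Dec (P a)) → Dec (∃ P)

  searchMaybe : ∀ {A} → Searchable A → Searchable (Maybe A)
  searchMaybe s P P? with P? nothing | s (P ∘ just) (P? ∘ just)
  ... | yes p | _           = yes (nothing , p)
  ... | no _  | yes (a , p) = yes (just a , p)
  ... | no ¬p | no ¬q       = no λ { (nothing , p) → ¬p p ; (just a , p) → ¬q (a , p) }

  searchVec : ∀ {A} → Searchable A → ∀ n → Searchable (Vec A n)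
  searchVec s zero    P P? = map′ ([] ,_) (λ { ([] , p) → p }) (P? [])
  searchVec s (suc n) P P? =
    map′ (λ (a , as , p) → a ∷ as , p) (λ { (a ∷ as , p) → a , as , p })
         (s _ λ a → searchVec s n _ λ as → P? (a ∷ as))

  searchFin : ∀ n → Searchable (Fin n)
  searchFin n P P? = any? P?

  search⇒all? : ∀ {A} → Searchable A → (P : A → Set) → (∀ a → Dec (P a)) → Dec (∀ a → P a)
  search⇒all? s P P? with s (¬_ ∘ P) (¬? ∘ P?)
  ... | yes (a , ¬p) = no λ p → ¬p (p a)
  ... | no ¬∃        = yes λ a → decidable-stable (P? a) λ ¬p → ¬∃ (a , ¬p)

  tri? : ∀ {A B C : Set} → Dec A → Dec B → Dec C → Dec (Tri A B C)
  tri? (yes a) (no ¬b) (no ¬c) = yes (tri< a ¬b ¬c)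
  tri? (no ¬a) (yes b) (no ¬c) = yes (tri≈ ¬a b ¬c)
  tri? (no ¬a) (no ¬b) (yes c) = yes (tri> ¬a ¬b c)
  tri? (yes a) (yes b) _       = no λ { (tri< _ ¬b _) → ¬b b ; (tri≈ ¬a _ _) → ¬a a ; (tri> ¬a _ _) → ¬a a }
  tri? (yes a) (no _)  (yes c) = no λ { (tri< _ _ ¬c) → ¬c c ; (tri≈ ¬a _ _) → ¬a a ; (tri> ¬a _ _) → ¬a a }
  tri? (no _)  (yes b) (yes c) = no λ { (tri< _ _ ¬c) → ¬c c ; (tri≈ _ _ ¬c) → ¬c c ; (tri> _ ¬b _) → ¬b b }
  tri? (no ¬a) (no ¬b) (no ¬c) = no λ { (tri< a _ _) → ¬a a ; (tri≈ _ b _) → ¬b b ; (tri> _ _ c) → ¬c c }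

  -- A coloured tournament as a matrix: the entry at (u , v) is just the colour
  -- of the arc from u to v, or nothing if there is no such arc.
  Matrix : ℕ → ℕ → Set
  Matrix m t = Vec (Vec (Maybe (Fin t)) m) m

  entry : ∀ {m t} → Matrix m t → Fin m → Fin m → Maybe (Fin t)
  entry M u v = lookup (lookup M u) v

  HasArc : ∀ {m t} → Matrix m t → Rel (Fin m) 0ℓ
  HasArc M u v = Is-just (entry M u v)

  Valid : ∀ {m t} → Matrix m t → Set
  Valid M = Trichotomous _≡_ (HasArc M)

  MatrixUnavoidable : ∀ {t} → Vec ℕ t → ∀ {m} → Matrix m t → Set
  MatrixUnavoidable ns {m} M = Valid M →
    ∃ λ i → Σ (Vec (Fin m) (lookup ns i)) (AllPairs λ u v → entry M u v ≡ just i)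

  matrixUnavoidable? : ∀ {t} (ns : Vec ℕ t) {m} (M : Matrix m t) → Dec (MatrixUnavoidable ns M)
  matrixUnavoidable? ns {m} M =
    (all? λ u → all? λ v → tri? (arc? u v) (u ≟ v) (arc? v u))
    →-dec any? λ i → searchVec (searchFin m) _ _
            (AllPairs.allPairs? λ u v → ≡-dec _≟_ (entry M u v) (just i))
    where
    arc? : ∀ u v → Dec (HasArc M u v)
    arc? u v = MaybeAny.dec (λ _ → yes tt) (entry M u v)

  module Decode {m t} (M : Matrix m t) (valid : Valid M) where
    T : Tournament m
    T = record { _⟶_ = HasArc M ; compare = valid }

    fromIsJust : (x : Maybe (Fin t)) → .(Is-just x) → Fin t
    fromIsJust (just i) _ = i
    fromIsJust nothing  p = ⊥-elim-irr (absurd p)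
      where
      absurd : Is-just {A = Fin t} nothing → ⊥
      absurd ()

    colour : Colouring T t
    colour u v e = fromIsJust (entry M u v) e

    entry-just : ∀ {i} (x : Maybe (Fin t)) (p : Is-just x) → fromIsJust x p ≡ i → x ≡ just i
    entry-just (just _) _ refl = refl

  module Encode {m t} (T : Tournament m) (colour : Colouring T t) where
    open Tournament T

    fromTri : ∀ u v → Tri (u ⟶ v) (u ≡ v) (v ⟶ u) → Maybe (Fin t)
    fromTri u v (tri< e _ _) = just (colour u v e)
    fromTri u v (tri≈ _ _ _) = nothing
    fromTri u v (tri> _ _ _) = nothing

    M : Matrix m t
    M = tabulate λ u → tabulate λ v → fromTri u v (compare u v)

    entry-M : ∀ u v → entry M u v ≡ fromTri u v (compare u v)
    entry-M u v = trans (cong (λ row → lookup row v) (lookup∘tabulate _ u)) (lookup∘tabulate _ v)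

    arc⇒ : ∀ {u v} → u ⟶ v → HasArc M u v
    arc⇒ {u} {v} e = subst Is-just (sym (entry-M u v)) (go (compare u v))
      where
      go : ∀ c → Is-just (fromTri u v c)
      go (tri< _ _ _)  = MaybeAny.just tt
      go (tri≈ ¬e _ _) = contradiction e ¬e
      go (tri> ¬e _ _) = contradiction e ¬e

    arc⇐ : ∀ {u v} → HasArc M u v → u ⟶ v
    arc⇐ {u} {v} p = go (compare u v) (subst Is-just (entry-M u v) p)
      where
      go : ∀ c → Is-just (fromTri u v c) → u ⟶ v
      go (tri< e _ _) _ = e

    valid : Valid M
    valid u v with compare u v
    ... | tri< e u≢v ¬e′ = tri< (arc⇒ e) u≢v (¬e′ ∘ arc⇐)
    ... | tri≈ ¬e u≡v ¬e′ = tri≈ (¬e ∘ arc⇐) u≡v (¬e′ ∘ arc⇐)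
    ... | tri> ¬e u≢v e′ = tri> (¬e ∘ arc⇐) u≢v (arc⇒ e′)

    entry⇒arc : ∀ {i u v} → entry M u v ≡ just i → ColouredArc T colour i u v
    entry⇒arc {i} {u} {v} eq = go (compare u v) (trans (sym (entry-M u v)) eq)
      where
      go : ∀ c → fromTri u v c ≡ just i → ColouredArc T colour i u v
      go (tri< e _ _) eq = e , just-injective eq

  unavoidable? : ∀ {t} (ns : Vec ℕ t) m → Dec (Unavoidable ns m)
  unavoidable? {t} ns m = map′ to from
    (search⇒all? (searchVec (searchVec (searchMaybe (searchFin t)) m) m)
                 (MatrixUnavoidable ns) (matrixUnavoidable? ns))
    where
    to : (∀ M → MatrixUnavoidable ns M) → Unavoidable ns m
    to f T colour =
      let open Encode T colour
          i , as , chain = f M valid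
      in i , as , AllPairs.map entry⇒arc chain
    from : Unavoidable ns m → ∀ M → MatrixUnavoidable ns M
    from f M valid =
      let open Decode M valid
          i , as , chain = f T colour
      in i , as , AllPairs.map (λ {u} {v} (e , eq) → entry-just (entry M u v) e eq) chain

  least : (P : ℕ → Set₁) → (∀ n → Dec (P n)) → ∀ n → P n →
          ∃ λ m → P m × (∀ k → P k → m ≤ k)
  least P P? n p with P? 0
  ... | yes p₀ = 0 , p₀ , λ _ _ → z≤n
  least P P? zero    p | no ¬p₀ = contradiction p ¬p₀
  least P P? (suc n) p | no ¬p₀ with m , pm , min ← least (P ∘ suc) (P? ∘ suc) n p =
    suc m , pm , λ { zero p₀ → contradiction p₀ ¬p₀ ; (suc k) pk → s≤s (min k pk) }

-- Abstract so that type checking never unfolds the search for the least order.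
abstract
  ramseyNumber : ∀ {t} (ns : Vec ℕ t) → ∃ (IsRamseyNumber ns)
  ramseyNumber ns with N , unavoidable ← some-unavoidable ns =
    least (Unavoidable ns) (unavoidable? ns) N unavoidable

ramsey : ∀ {t} → Vec ℕ t → ℕ
ramsey ns = proj₁ (ramseyNumber ns)

ramsey-isRamseyNumber : ∀ {t} (ns : Vec ℕ t) → IsRamseyNumber ns (ramsey ns)
ramsey-isRamseyNumber ns = proj₂ (ramseyNumber ns)

R : ℕ → ℕ → ℕ
R t n = ramsey (replicate t n)

{-# OPTIONS --safe #-}
module Submission where

-- The bound is witnessed by a tournament of order 43 * 3 ^ (t ∸ 3) with
-- t colours and no monochromatic transitive triple.
--
-- For t = 3 take the Paley tournament on ℤ/43, in which u ⟶ v when v - u is a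
-- nonzero square; it is a tournament because -1 is not a square modulo 43. Let
-- H be the group of nonzero sixth powers, which has order 7. The squares are
-- the union of three cosets of H, told apart by the seventh power of an
-- element, and the coset of v - u is the colour of the arc. A monochromatic
-- transitive triple would give x, y and x + y in one coset of H; dividing by x
-- would give h and 1 + h in H, but H = {1, 4, 11, 16, 21, 35, 41} contains no
-- two consecutive residues. Both facts about squares and cosets are verified
-- by evaluation over pairs of residues (paley₄₃); what makes pairs suffice is
-- that differences add up (difference-+).
--
-- One more colour triples the order: substitute a copy of the tournament for
-- each vertex of the cyclic triangle, and give the arcs between different
-- copies the new colour. A triple of the new colour has its vertices in three
-- different copies, so it is cyclic (lexicographic).
--
-- Finally, such a tournament of order n restricts to any smaller order, so no
-- m ≤ n is unavoidable (tripleFree⇒<ramsey).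

open import Defs
open import Data.Nat using (ℕ; _+_; _*_; _∸_; _^_; _≤_)

open import Level using (0ℓ)
open import Data.Fin.Base using (Fin; zero; suc; toℕ; splitAt; combine; inject≤)
open import Data.Fin.Properties
  using (toℕ<n; toℕ-injective; splitAt-join; combine-remQuot; inject≤-injective)
  renaming (_≟_ to _≟ᶠ_)
open import Data.Nat.Base using (suc; _<_; s≤s; NonZero)
open import Data.Nat.DivMod
  using (_%_; m%n<n; n%n≡0; m<n⇒m%n≡m; [m+n]%n≡m%n; %-distribˡ-+)
open import Data.Nat.Properties
  using (_≟_; allUpTo?; ≰⇒>; _≤?_; <⇒≤; +-comm; m+[n∸m]≡n)
open import Data.Nat.Solver using (module +-*-Solver)
open import Data.Product.Base using (_×_; _,_; proj₁; proj₂; uncurry)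
open import Data.Product.Relation.Binary.Lex.Strict using (×-Lex; ×-compare)
open import Data.Product.Relation.Binary.Pointwise.NonDependent using (≡×≡⇒≡; ≡⇒≡×≡)
open import Data.Sum.Base using (_⊎_; inj₁; inj₂)
open import Data.Sum.Properties using (inj₁-injective; inj₂-injective)
open import Data.Vec.Base using ([]; _∷_; replicate)
open import Data.Vec.Properties using (lookup-replicate)
open import Data.Vec.Relation.Unary.All using ([]; _∷_)
open import Data.Vec.Relation.Unary.AllPairs using ([]; _∷_)
open import Function.Base using (_∘_)
open import Function.Definitions using (Injective)
open import Relation.Binary.Core using (Rel)
open import Relation.Binary.Definitions using (Trichotomous; tri<; tri≈; tri>)
open import Relation.Binary.PropositionalEquality
  using (_≡_; refl; sym; trans; cong; subst; module ≡-Reasoning)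
open import Relation.Nullary using (¬_; Dec; yes; no; contradiction; ¬?)
open import Relation.Nullary.Decidable using (from-yes; _→-dec_; _×-dec_; _⊎-dec_)
import Relation.Unary as Unary

-- Tournaments without monochromatic transitive triples

-- A tournament on V with its arcs coloured in C and no monochromatic
-- transitive triple. The values of colour at pairs that are not arcs are
-- arbitrary.
record TripleFree (V C : Set) : Set₁ where
  field
    _⟶_     : Rel V 0ℓ
    compare : Trichotomous _≡_ _⟶_
    colour  : V → V → C
    free    : ∀ {u v w} → u ⟶ v → v ⟶ w → u ⟶ w →
              colour u v ≡ colour v w → ¬ colour u v ≡ colour u w

relabel : ∀ {V W C D} {f : W → V} {g : C → D} →
          Injective _≡_ _≡_ f → Injective _≡_ _≡_ g → TripleFree V C → TripleFree W D
relabel {W = W} {f = f} {g} f-inj g-inj G = record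
  { _⟶_     = λ u v → f u ⟶ f v
  ; compare = compare′
  ; colour  = λ u v → g (colour (f u) (f v))
  ; free    = λ uv vw uw p q → free uv vw uw (g-inj p) (g-inj q)
  }
  where
  open TripleFree G
  compare′ : Trichotomous _≡_ (λ (u v : W) → f u ⟶ f v)
  compare′ u v with compare (f u) (f v)
  ... | tri< a ¬b ¬c = tri< a (¬b ∘ cong f) ¬c
  ... | tri≈ ¬a b ¬c = tri≈ ¬a (f-inj b) ¬c
  ... | tri> ¬a ¬b c = tri> ¬a (¬b ∘ cong f) c

leftInverse⇒injective : ∀ {A B : Set} {f : A → B} (g : B → A) →
                        (∀ x → g (f x) ≡ x) → Injective _≡_ _≡_ f
leftInverse⇒injective g gf {x} {y} fx≡fy = trans (sym (gf x)) (trans (cong g fx≡fy) (gf y))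

-- The lexicographic product: each vertex of G is replaced by a copy of H. Arcs
-- between different copies are coloured as in G, arcs within a copy as in H,
-- and the two palettes are disjoint.
module Lexicographic {V W C D} (G : TripleFree V C) (H : TripleFree W D) where
  private
    module G = TripleFree G
    module H = TripleFree H

  _⟶_ : Rel (V × W) 0ℓ
  _⟶_ = ×-Lex _≡_ G._⟶_ H._⟶_

  compare : Trichotomous _≡_ _⟶_
  compare x y with ×-compare sym G.compare H.compare x y
  ... | tri< a ¬b ¬c = tri< a (¬b ∘ ≡⇒≡×≡) ¬c
  ... | tri≈ ¬a b ¬c = tri≈ ¬a (≡×≡⇒≡ b) ¬c
  ... | tri> ¬a ¬b c = tri> ¬a (¬b ∘ ≡⇒≡×≡) c

  colour : V × W → V × W → C ⊎ D
  colour (v , w) (v′ , w′) with G.compare v v′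
  ... | tri≈ _ _ _ = inj₂ (H.colour w w′)
  ... | _          = inj₁ (G.colour v v′)

  arcColour : ∀ {x y} → x ⟶ y → C ⊎ D
  arcColour {v , _} {v′ , _} (inj₁ _) = inj₁ (G.colour v v′)
  arcColour {_ , w} {_ , w′} (inj₂ _) = inj₂ (H.colour w w′)

  colour≡arcColour : ∀ {x y} (e : x ⟶ y) → colour x y ≡ arcColour e
  colour≡arcColour {v , _} {v′ , _} (inj₁ e) with G.compare v v′
  ... | tri< _ _ _  = refl
  ... | tri≈ ¬e _ _ = contradiction e ¬e
  ... | tri> _ _ _  = refl
  colour≡arcColour {v , _} {v′ , _} (inj₂ (v≡v′ , _)) with G.compare v v′
  ... | tri< _ v≢v′ _ = contradiction v≡v′ v≢v′
  ... | tri≈ _ _ _    = refl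
  ... | tri> _ v≢v′ _ = contradiction v≡v′ v≢v′

  -- Disjointness of the palettes leaves only the triples with all three arcs
  -- between copies and those within one copy.
  arcColour-free : ∀ {x y z} (xy : x ⟶ y) (yz : y ⟶ z) (xz : x ⟶ z) →
                   arcColour xy ≡ arcColour yz → ¬ arcColour xy ≡ arcColour xz
  arcColour-free (inj₁ xy) (inj₁ yz) (inj₁ xz) p q =
    G.free xy yz xz (inj₁-injective p) (inj₁-injective q)
  arcColour-free (inj₂ (_ , xy)) (inj₂ (_ , yz)) (inj₂ (_ , xz)) p q =
    H.free xy yz xz (inj₂-injective p) (inj₂-injective q)
  arcColour-free (inj₁ _) (inj₂ _) _        ()
  arcColour-free (inj₂ _) (inj₁ _) _        ()
  arcColour-free (inj₁ _) (inj₁ _) (inj₂ _) _ ()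
  arcColour-free (inj₂ _) (inj₂ _) (inj₁ _) _ ()

  lexicographic : TripleFree (V × W) (C ⊎ D)
  lexicographic = record
    { _⟶_     = _⟶_
    ; compare = compare
    ; colour  = colour
    ; free    = λ xy yz xz p q → arcColour-free xy yz xz
        (trans (sym (colour≡arcColour xy)) (trans p (colour≡arcColour yz)))
        (trans (sym (colour≡arcColour xy)) (trans q (colour≡arcColour xz)))
    }

open Lexicographic using (lexicographic)

-- The lexicographic product on initial segments of ℕ, with the colours of the
-- outer factor listed first.
product : ∀ {m n s t} → TripleFree (Fin m) (Fin s) → TripleFree (Fin n) (Fin t) →
          TripleFree (Fin (m * n)) (Fin (s + t))
product {m} {n} {s} {t} G H = relabel
  (leftInverse⇒injective (uncurry combine) (combine-remQuot {m} n))
  (leftInverse⇒injective (splitAt s) (splitAt-join s t))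
  (lexicographic G H)

-- Circulant tournaments

-- The residue of v - u modulo n.
difference : ∀ {n} .{{_ : NonZero n}} → Fin n → Fin n → ℕ
difference {n} u v = (toℕ v + (n ∸ toℕ u)) % n

module _ {n : ℕ} .{{_ : NonZero n}} where
  open ≡-Reasoning
  open +-*-Solver using (solve; _:+_; _:=_)

  difference<n : (u v : Fin n) → difference u v < n
  difference<n u v = m%n<n _ n

  m+[n∸m] : (u : Fin n) → toℕ u + (n ∸ toℕ u) ≡ n
  m+[n∸m] u = m+[n∸m]≡n (<⇒≤ (toℕ<n u))

  difference-+ : (u v w : Fin n) → (difference u v + difference v w) % n ≡ difference u w
  difference-+ u v w = begin
    (difference u v + difference v w) % n  ≡⟨ %-distribˡ-+ (toℕ v + u′) (toℕ w + v′) n ⟨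
    ((toℕ v + u′) + (toℕ w + v′)) % n      ≡⟨ cong (_% n) (solve 4 (λ v u′ w v′ →
                                                (v :+ u′) :+ (w :+ v′) := (w :+ u′) :+ (v :+ v′))
                                                refl (toℕ v) u′ (toℕ w) v′) ⟩
    ((toℕ w + u′) + (toℕ v + v′)) % n      ≡⟨ cong (λ k → ((toℕ w + u′) + k) % n) (m+[n∸m] v) ⟩
    ((toℕ w + u′) + n) % n                 ≡⟨ [m+n]%n≡m%n (toℕ w + u′) n ⟩
    difference u w                         ∎
    where
    u′ = n ∸ toℕ u
    v′ = n ∸ toℕ v

  difference-self : (u : Fin n) → difference u u ≡ 0
  difference-self u = trans (cong (_% n) (m+[n∸m] u)) (n%n≡0 n)

  difference-cancel : (u v : Fin n) → (difference u v + toℕ u) % n ≡ toℕ v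
  difference-cancel u v = begin
    (difference u v + toℕ u) % n     ≡⟨ cong (λ k → (difference u v + k) % n) (m<n⇒m%n≡m (toℕ<n u)) ⟨
    (difference u v + toℕ u % n) % n ≡⟨ %-distribˡ-+ (toℕ v + u′) (toℕ u) n ⟨
    (toℕ v + u′ + toℕ u) % n         ≡⟨ cong (_% n) (solve 3 (λ v u′ u →
                                          v :+ u′ :+ u := v :+ (u :+ u′)) refl (toℕ v) u′ (toℕ u)) ⟩
    (toℕ v + (toℕ u + u′)) % n       ≡⟨ cong (λ k → (toℕ v + k) % n) (m+[n∸m] u) ⟩
    (toℕ v + n) % n                  ≡⟨ [m+n]%n≡m%n (toℕ v) n ⟩
    toℕ v % n                        ≡⟨ m<n⇒m%n≡m (toℕ<n v) ⟩
    toℕ v                            ∎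
    where
    u′ = n ∸ toℕ u

  difference≡0⇒≡ : (u v : Fin n) → difference u v ≡ 0 → u ≡ v
  difference≡0⇒≡ u v d≡0 = toℕ-injective (begin
    toℕ u                        ≡⟨ m<n⇒m%n≡m (toℕ<n u) ⟨
    (0 + toℕ u) % n              ≡⟨ cong (λ d → (d + toℕ u) % n) d≡0 ⟨
    (difference u v + toℕ u) % n ≡⟨ difference-cancel u v ⟩
    toℕ v                        ∎)

module _ (n : ℕ) .{{_ : NonZero n}} {C : Set} (S : ℕ → Set) (κ : ℕ → C) where

  -- S contains exactly one of x and -x for each nonzero residue x modulo n,
  -- and not 0.
  Oriented : Set
  Oriented = ∀ {x} → x < n → ∀ {y} → y < n → (x + y) % n ≡ 0 →
             ¬ (S x × S y) × (x ≡ 0 ⊎ S x ⊎ S y)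

  -- No colour class of κ on S contains x, y and x + y, where x and y may be
  -- equal.
  SumFree : Set
  SumFree = ∀ {x} → x < n → ∀ {y} → y < n → S x → S y → S ((x + y) % n) →
            κ x ≡ κ y → ¬ κ x ≡ κ ((x + y) % n)

  -- The tournament on the residues modulo n with u ⟶ v when v - u lies in S,
  -- each arc coloured by κ (v - u).
  circulant : Oriented → SumFree → TripleFree (Fin n) C
  circulant oriented sumFree = record
    { _⟶_     = _⟶_
    ; compare = compare
    ; colour  = λ u v → κ (difference u v)
    ; free    = λ {u} {v} {w} uv vw uw p q →
        sumFree (difference<n u v) (difference<n v w) uv vw
          (subst S (sym (difference-+ u v w)) uw) p
          (trans q (cong κ (sym (difference-+ u v w))))
    }
    where
    _⟶_ : Rel (Fin n) 0ℓ
    u ⟶ v = S (difference u v)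

    either : ∀ u v → ¬ (u ⟶ v × v ⟶ u) × (difference u v ≡ 0 ⊎ u ⟶ v ⊎ v ⟶ u)
    either u v = oriented (difference<n u v) (difference<n v u)
                   (trans (difference-+ u v u) (difference-self u))

    asym : ∀ u v → u ⟶ v → ¬ v ⟶ u
    asym u v uv vu = proj₁ (either u v) (uv , vu)

    irrefl : ∀ u v → u ⟶ v → ¬ u ≡ v
    irrefl u u e refl = asym u u e e

    compare : Trichotomous _≡_ _⟶_
    compare u v with proj₂ (either u v)
    ... | inj₁ d≡0 = tri≈ (λ e → irrefl u v e u≡v) u≡v (λ e → irrefl v u e (sym u≡v))
      where u≡v = difference≡0⇒≡ u v d≡0
    ... | inj₂ (inj₁ uv) = tri< uv (irrefl u v uv) (asym u v uv)
    ... | inj₂ (inj₂ vu) = tri> (asym v u vu) (irrefl v u vu ∘ sym) vu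

  module _ (S? : Unary.Decidable S) (_≟ᶜ_ : ∀ (a b : C) → Dec (a ≡ b)) where

    oriented? : Dec Oriented
    oriented? = allUpTo? (λ x → allUpTo? (λ y → ((x + y) % n ≟ 0) →-dec
      (¬? (S? x ×-dec S? y) ×-dec ((x ≟ 0) ⊎-dec (S? x ⊎-dec S? y)))) n) n

    sumFree? : Dec SumFree
    sumFree? = allUpTo? (λ x → allUpTo? (λ y →
      S? x →-dec (S? y →-dec (S? ((x + y) % n) →-dec
        ((κ x ≟ᶜ κ y) →-dec ¬? (κ x ≟ᶜ κ ((x + y) % n)))))) n) n

cyclicTriangle : TripleFree (Fin 3) (Fin 1)
cyclicTriangle = circulant 3 S κ (from-yes (oriented? 3 S κ S? _≟ᶠ_))
                                 (from-yes (sumFree? 3 S κ S? _≟ᶠ_))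
  where
  S : ℕ → Set
  S x = x ≡ 1
  S? : Unary.Decidable S
  S? x = x ≟ 1
  κ : ℕ → Fin 1
  κ _ = zero

-- The Paley tournament modulo 43, with an arc coloured by the coset of the
-- group of sixth powers that contains its difference.
paley₄₃ : TripleFree (Fin 43) (Fin 3)
paley₄₃ = circulant 43 Square κ (from-yes (oriented? 43 Square κ Square? _≟ᶠ_))
                                (from-yes (sumFree? 43 Square κ Square? _≟ᶠ_))
  where
  -- Euler's criterion for nonzero squares.
  Square : ℕ → Set
  Square x = x ^ 21 % 43 ≡ 1
  Square? : Unary.Decidable Square
  Square? x = x ^ 21 % 43 ≟ 1

  -- The seventh power of a nonzero square is a cube root of unity, that is 1, 6
  -- or 36. The last clause stands for 36; its value at nonsquares is immaterial.
  cubeRootIndex : ℕ → Fin 3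
  cubeRootIndex 1 = zero
  cubeRootIndex 6 = suc zero
  cubeRootIndex _ = suc (suc zero)

  κ : ℕ → Fin 3
  κ x = cubeRootIndex (x ^ 7 % 43)

-- Lower bounds for Ramsey numbers

-- The Paley tournament modulo 43, substituted k times
-- in succession for the vertices of the cyclic triangle.
iterated : ∀ k → TripleFree (Fin (43 * 3 ^ k)) (Fin (3 + k))
iterated 0       = paley₄₃
iterated (suc k) = subst (λ n → TripleFree (Fin n) (Fin (4 + k))) order
                     (product cyclicTriangle (iterated k))
  where
  open +-*-Solver using (solve; _:*_; _:=_; con)
  order : 3 * (43 * 3 ^ k) ≡ 43 * 3 ^ suc k
  order = solve 1 (λ p → con 3 :* (con 43 :* p) := con 43 :* (con 3 :* p)) refl (3 ^ k)

tripleFree⇒¬unavoidable : ∀ {m t} → TripleFree (Fin m) (Fin t) → ¬ Unavoidable (replicate t 3) m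
tripleFree⇒¬unavoidable {m} {t} G unavoidable = uncurry
  (λ i → noTriple i ∘ subst (MonochromaticTransitive T κ i) (lookup-replicate i 3))
  (unavoidable T κ)
  where
  open TripleFree G
  T : Tournament m
  T = record { _⟶_ = _⟶_ ; compare = compare }
  κ : Colouring T t
  κ u v _ = colour u v

  noTriple : ∀ i → ¬ MonochromaticTransitive T κ i 3
  noTriple i (_ ∷ _ ∷ _ ∷ [] , ((ab , p) ∷ (ac , q) ∷ []) ∷ ((bc , r) ∷ []) ∷ [] ∷ []) =
    free ab bc ac (trans p (sym r)) (trans p (sym q))

tripleFree⇒<ramsey : ∀ {n t} → TripleFree (Fin n) (Fin t) → n < R t 3
tripleFree⇒<ramsey {n} {t} G with R t 3 ≤? n
... | no R≰n  = ≰⇒> R≰n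
... | yes R≤n = contradiction (proj₁ (ramsey-isRamseyNumber (replicate t 3)))
                  (tripleFree⇒¬unavoidable
                    (relabel (λ {i} {j} → inject≤-injective R≤n R≤n i j) (λ e → e) G))

corollary2p9 : ∀ (t : ℕ) → 3 ≤ t → 43 * 3 ^ (t ∸ 3) + 1 ≤ R t 3
corollary2p9 (suc (suc (suc k))) (s≤s (s≤s (s≤s _))) =
  subst (_≤ R (3 + k) 3) (+-comm 1 (43 * 3 ^ k)) (tripleFree⇒<ramsey (iterated k))
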